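{- Let $\ell\ge 1$ be a fixed integer. As $x\to\infty$, $$q_\ell(x)=\frac{\sqrt{2x}}{\log x}\left(1+O_\ell(x^{ -1/2})\right).$$ In particular, $q_\ell(x)\sim \sqrt{2x}/\log x$ as $x\to\infty$.
   Context: For an integer $\ell\ge1$ and $n\ge 1$ put $L_n^{(\ell)}=\frac{n(\ell(n-1)+2)}{2}$ and $h_n^{(\ell)}=L_{n+1}^{(\ell)}-L_n^{(\ell)}=1+\ell n$. For real $x$ let $\nu_\ell(x)=\frac{\sqrt{8\ell x+(\ell-2)^2}+\ell-2}{2\ell}$ (the positive real solution $t$ of $\frac{t(\ell(t-1)+2)}{2}=x$) and $n_x^{(\ell)}=\lceil \nu_\ell(x)\rceil$. Thus with $n=n_x^{(\ell)}$ one has $L_{n-1}^{(\ell)}<x\le L_n^{(\ell)}$. For $x\ge L_2^{(\ell)}$ define $$q_\ell(x)=\frac{h_{n_x^{(\ell)}-1}^{(\ell)}}{\sqrt{\ell}\,\log L_{n_x^{(\ell)}}^{(\ell)}}.$$ The implied constant in $O_\ell$ may depend on $\ell$ but not on $x$. -}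

module Defs where

open import Algebra.Bundles using (CommutativeRing; Semiring)
open import Algebra.Structures using (IsCommutativeRing)
open import Data.Fin.Base using (toℕ)
open import Data.Nat.Base as ℕ using (ℕ; zero; suc; _!)
open import Data.Product.Base using (∃; ∃-syntax; proj₁)
open import Level using (0ℓ)
open import Relation.Binary.Core using (Rel)
open import Relation.Binary.Structures using (IsDecTotalOrder)
open import Relation.Nullary using (¬_; yes; no)
import Algebra.Definitions.RawSemiring as RawSemiringDefinitions
import Relation.Binary.Construct.NonStrictToStrict as NonStrictToStrict

-- The real numbers, axiomatised classically as the Dedekind-complete ordered
-- field, which is unique up to isomorphism.
--
-- _⁻¹ and sup are total, but constrained only on nonzero arguments and on
-- inhabited bounded sets.  Decidability of the order and the Archimedean axiom
-- follow from the remaining axioms in classical logic; they are stated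
-- because they do not follow from them in Agda.

record RealNumbers : Set₁ where
  infix  9 _⁻¹
  infix  8 -_
  infixl 7 _*_
  infixl 6 _+_
  infix  4 _≈_ _≤_

  field
    Carrier           : Set
    _≈_               : Rel Carrier 0ℓ
    _≤_               : Rel Carrier 0ℓ
    _+_ _*_           : Carrier → Carrier → Carrier
    -_ _⁻¹            : Carrier → Carrier
    0# 1#             : Carrier
    isCommutativeRing : IsCommutativeRing _≈_ _+_ _*_ -_ 0# 1#
    isDecTotalOrder   : IsDecTotalOrder _≈_ _≤_

    1≉0               : ¬ (1# ≈ 0#)
    ⁻¹-cong           : ∀ {x y} → x ≈ y → x ⁻¹ ≈ y ⁻¹
    ⁻¹-inverseʳ       : ∀ x → ¬ (x ≈ 0#) → x * x ⁻¹ ≈ 1#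

    +-monoˡ-≤         : ∀ z {x y} → x ≤ y → x + z ≤ y + z
    *-nonNegative     : ∀ {x y} → 0# ≤ x → 0# ≤ y → 0# ≤ x * y

  commutativeRing : CommutativeRing 0ℓ 0ℓ
  commutativeRing = record { isCommutativeRing = isCommutativeRing }

  open CommutativeRing commutativeRing public using (_-_; semiring)
  open RawSemiringDefinitions (Semiring.rawSemiring semiring) public
    using (_^_; sum) renaming (_×_ to _·_)
  open NonStrictToStrict _≈_ _≤_ public using (_<_)
  open IsDecTotalOrder isDecTotalOrder public using (_≟_; _≤?_)

  fromℕ : ℕ → Carrier
  fromℕ n = n · 1#

  IsUpperBound : (Carrier → Set) → Carrier → Set
  IsUpperBound P u = ∀ x → P x → x ≤ u

  field
    archimedean : ∀ x → ∃[ n ] x ≤ fromℕ n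
    sup         : (Carrier → Set) → Carrier
    sup-upper   : ∀ P → ∃ P → ∃ (IsUpperBound P) → IsUpperBound P (sup P)
    sup-least   : ∀ P → ∃ P → ∃ (IsUpperBound P) →
                  ∀ u → IsUpperBound P u → sup P ≤ u

module Analysis (𝓡 : RealNumbers) where

  open RealNumbers 𝓡 public renaming (Carrier to ℝ)

  infixl 7 _/_
  _/_ : ℝ → ℝ → ℝ
  x / y = x * y ⁻¹

  ∣_∣ : ℝ → ℝ
  ∣ x ∣ with 0# ≤? x
  ... | yes _ = x
  ... | no  _ = - x

  √_ : ℝ → ℝ
  √ x = sup (λ y → y * y ≤ x)

  -- The limit inferior, hence the limit of every convergent sequence.
  lim : (ℕ → ℝ) → ℝ
  lim a = sup (λ z → ∃[ N ] (∀ n → N ℕ.≤ n → z ≤ a n))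

  exp : ℝ → ℝ
  exp y = lim (λ N → sum {N} (λ k → y ^ toℕ k / fromℕ (toℕ k !)))

  -- The inverse of the increasing bijection exp : ℝ → (0,∞); meaningful for
  -- 0 < x.
  log : ℝ → ℝ
  log x = sup (λ y → exp y ≤ x)

  -- The least n : ℕ with x ≤ n; it equals the usual integer ceiling when -1 < x.
  -- ceilBelow x m is the least such n provided that x ≤ m.
  ceilBelow : ℝ → ℕ → ℕ
  ceilBelow x zero = zero
  ceilBelow x (suc m) with x ≤? fromℕ m
  ... | yes _ = ceilBelow x m
  ... | no  _ = suc m

  ⌈_⌉ : ℝ → ℕ
  ⌈ x ⌉ = ceilBelow x (proj₁ (archimedean x))

  -- Landau notation for x → ∞.

  EventuallyAtTop : (ℝ → Set) → Set
  EventuallyAtTop P = ∃[ X ] (∀ x → X ≤ x → P x)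

  IsBigO : (ℝ → ℝ) → (ℝ → ℝ) → Set
  IsBigO f g = ∃[ C ] EventuallyAtTop (λ x → ∣ f x ∣ ≤ C * ∣ g x ∣)

  IsAsymptotic : (ℝ → ℝ) → (ℝ → ℝ) → Set
  IsAsymptotic f g =
    ∀ ε → 0# < ε → EventuallyAtTop (λ x → ∣ f x / g x - 1# ∣ ≤ ε)

  -- For ℓ ≥ 1 these are L_n^(ℓ), h_n^(ℓ), ν_ℓ(x), n_x^(ℓ) and q_ℓ(x).

  L : ℕ → ℕ → ℝ
  L ℓ n = fromℕ n * (fromℕ ℓ * (fromℕ n - 1#) + fromℕ 2) / fromℕ 2

  h : ℕ → ℕ → ℝ
  h ℓ n = L ℓ (suc n) - L ℓ n

  ν : ℕ → ℝ → ℝ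
  ν ℓ x =
    (√ (fromℕ 8 * fromℕ ℓ * x + (fromℕ ℓ - fromℕ 2) ^ 2) + (fromℕ ℓ - fromℕ 2))
      / (fromℕ 2 * fromℕ ℓ)

  index : ℕ → ℝ → ℕ
  index ℓ x = ⌈ ν ℓ x ⌉

  -- Meaningful for x ≥ L ℓ 2, where index ℓ x ≥ 2.
  q : ℕ → ℝ → ℝ
  q ℓ x = h ℓ (ℕ.pred (index ℓ x)) / (√ (fromℕ ℓ) * log (L ℓ (index ℓ x)))

  mainTerm : ℝ → ℝ
  mainTerm x = √ (fromℕ 2 * x) / log x

{-# OPTIONS --safe #-}
module Submission where

-- Put s = √x, n = n_x, H = h_{n-1} and W = √ℓ √(2x).  Completing the square in the
-- definition of ν gives |H − W| ≤ ℓ + 1 and x ≤ L_n ≤ x (1 + (ℓ + 1)/s), hence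
-- log x ≤ log L_n ≤ log x + (ℓ + 1)/s.  The relative error is
-- H log x / (W log L_n) − 1, and its size is at most 2 (ℓ + 1)/s because s ≤ W.
-- Only exponentials of nonnegative numbers matter: the bound
-- (1 + δ) exp z ≤ exp (z + δ), which holds term by term, replaces the functional
-- equation of the logarithm.

-- The obstacle is that `√`, `log` and `exp` are bare suprema over an abstract equality. An upper
-- estimate therefore exhibits an upper bound of the defining set, and a lower estimate exhibits an
-- element of it. Restricting `exp` to nonnegative arguments makes its partial sums increase, so
-- that the limit inferior in its definition is their least upper bound. The 2 in the error bound
-- counts two replacements: `H` by `W`, and `L_n` by `x` under the logarithm. The second is an
-- absolute error; it becomes a relative one because logarithms are at least 1 from `exp 1#` on,
-- which is why estimates start there.

open import Defs
open import Algebra.Bundles using (CommutativeRing)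
open import Algebra.Solver.Ring.AlmostCommutativeRing
  using (fromCommutativeRing; _-Raw-AlmostCommutative⟶_)
open import Data.Empty using (⊥-elim)
open import Data.Fin.Base using (toℕ)
open import Data.Integer.Base as ℤ using (ℤ; +_; -[1+_])
import Data.Integer.Properties as ℤ
import Data.Maybe.Base as Maybe
open import Data.Nat.Base as ℕ using (ℕ; zero; suc; _!)
open import Data.Product.Base using (_×_; ∃-syntax; _,_; proj₁; proj₂)
open import Data.Sum.Base using (inj₁; inj₂)
open import Relation.Binary.Consequences using (dec⇒weaklyDec)
open import Relation.Binary.Bundles using (Poset)
open import Relation.Binary.PropositionalEquality.Core as ≡ using (_≡_)
open import Relation.Binary.Structures using (IsDecTotalOrder)
open import Relation.Nullary using (¬_; yes; no)
import Algebra.Properties.AbelianGroup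
import Algebra.Properties.Ring
import Algebra.Properties.Semiring.Mult
import Algebra.Properties.Semiring.Mult.TCOptimised
import Algebra.Solver.Ring
import Data.Nat.Properties as ℕ
import Relation.Binary.Reasoning.PartialOrder
import Relation.Binary.Reasoning.Setoid

-- Ring identities with integer coefficients

-- Integer coefficients have decidable equality, so that the solver can cancel
-- opposite terms in rings where equality does not compute.
module IntegerCoefficients {c ℓ} (R : CommutativeRing c ℓ) where
  open CommutativeRing R
  open Algebra.Properties.Ring ring
  open Algebra.Properties.AbelianGroup +-abelianGroup using (⁻¹-∙-comm)
  open Algebra.Properties.Semiring.Mult.TCOptimised semiring
    using (×-homo-+; ×1-homo-*; 1+×) renaming (_×_ to _·_)
  open Relation.Binary.Reasoning.Setoid setoid

  -- With the optimised multiple, `embed (+ 1)` reduces to `1#` itself and not to `1# + 0#`, so the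
  -- constant `:1` denotes exactly `1#`.
  embed : ℤ → Carrier
  embed (+ n)    = n · 1#
  embed -[1+ n ] = - (suc n · 1#)

  embed-⊖ : ∀ m n → embed (m ℤ.⊖ n) ≈ m · 1# - n · 1#
  embed-⊖ zero zero = sym (-‿inverseʳ 0#)
  embed-⊖ zero (suc n) = sym (+-identityˡ _)
  embed-⊖ (suc m) zero = begin
    suc m · 1#        ≈⟨ +-identityʳ _ ⟨
    suc m · 1# + 0#   ≈⟨ +-congˡ -0#≈0# ⟨
    suc m · 1# - 0#   ∎
  embed-⊖ (suc m) (suc n) = begin
    embed (suc m ℤ.⊖ suc n)            ≡⟨ ≡.cong embed (ℤ.[1+m]⊖[1+n]≡m⊖n m n) ⟩
    embed (m ℤ.⊖ n)                    ≈⟨ embed-⊖ m n ⟩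
    m · 1# - n · 1#                    ≈⟨ +-congʳ (+-identityˡ _) ⟨
    0# + m · 1# - n · 1#               ≈⟨ +-congʳ (+-congʳ (-‿inverseʳ 1#)) ⟨
    1# - 1# + m · 1# - n · 1#          ≈⟨ +-congʳ (+-assoc _ _ _) ⟩
    1# + (- 1# + m · 1#) - n · 1#      ≈⟨ +-congʳ (+-congˡ (+-comm _ _)) ⟩
    1# + (m · 1# - 1#) - n · 1#        ≈⟨ +-congʳ (+-assoc _ _ _) ⟨
    1# + m · 1# - 1# - n · 1#          ≈⟨ +-assoc _ _ _ ⟩
    1# + m · 1# + (- 1# - n · 1#)      ≈⟨ +-cong (sym (1+× m 1#)) (⁻¹-∙-comm _ _) ⟩
    suc m · 1# - (1# + n · 1#)         ≈⟨ +-congˡ (-‿cong (1+× n 1#)) ⟨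
    suc m · 1# - suc n · 1#            ∎

  embed-neg : ∀ i → embed (ℤ.- i) ≈ - embed i
  embed-neg (+ zero)   = sym -0#≈0#
  embed-neg (+ suc n)  = refl
  embed-neg -[1+ n ]   = sym (-‿involutive _)

  embed-+ : ∀ i j → embed (i ℤ.+ j) ≈ embed i + embed j
  embed-+ (+ m)    (+ n)    = ×-homo-+ 1# m n
  embed-+ (+ m)    -[1+ n ] = embed-⊖ m (suc n)
  embed-+ -[1+ m ] (+ n)    = trans (embed-⊖ n (suc m)) (+-comm _ _)
  embed-+ -[1+ m ] -[1+ n ] = begin
    embed (-[1+ m ] ℤ.+ -[1+ n ])        ≡⟨ ≡.cong embed (ℤ.neg-distrib-+ (+ suc m) (+ suc n)) ⟨
    embed (ℤ.- (+ (suc m ℕ.+ suc n)))    ≈⟨ embed-neg (+ (suc m ℕ.+ suc n)) ⟩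
    - ((suc m ℕ.+ suc n) · 1#)           ≈⟨ -‿cong (×-homo-+ 1# (suc m) (suc n)) ⟩
    - (suc m · 1# + suc n · 1#)          ≈⟨ ⁻¹-∙-comm _ _ ⟨
    - (suc m · 1#) - suc n · 1#          ∎

  embed-pos-* : ∀ m j → embed (+ m ℤ.* j) ≈ m · 1# * embed j
  embed-pos-* m (+ n) = begin
    embed (+ m ℤ.* + n)   ≡⟨ ≡.cong embed (ℤ.pos-* m n) ⟨
    (m ℕ.* n) · 1#        ≈⟨ ×1-homo-* m n ⟩
    m · 1# * n · 1#       ∎
  embed-pos-* m -[1+ n ] = begin
    embed (+ m ℤ.* -[1+ n ])          ≡⟨ ≡.cong embed (ℤ.neg-distribʳ-* (+ m) (+ suc n)) ⟨
    embed (ℤ.- (+ m ℤ.* + suc n))     ≈⟨ embed-neg (+ m ℤ.* + suc n) ⟩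
    - embed (+ m ℤ.* + suc n)         ≈⟨ -‿cong (embed-pos-* m (+ suc n)) ⟩
    - (m · 1# * suc n · 1#)           ≈⟨ -‿distribʳ-* _ _ ⟩
    m · 1# * - (suc n · 1#)           ∎

  embed-* : ∀ i j → embed (i ℤ.* j) ≈ embed i * embed j
  embed-* (+ m)    j = embed-pos-* m j
  embed-* -[1+ m ] j = begin
    embed (-[1+ m ] ℤ.* j)         ≡⟨ ≡.cong embed (ℤ.neg-distribˡ-* (+ suc m) j) ⟨
    embed (ℤ.- (+ suc m ℤ.* j))    ≈⟨ embed-neg (+ suc m ℤ.* j) ⟩
    - embed (+ suc m ℤ.* j)        ≈⟨ -‿cong (embed-pos-* (suc m) j) ⟩
    - (suc m · 1# * embed j)       ≈⟨ -‿distribˡ-* _ _ ⟩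
    - (suc m · 1#) * embed j       ∎

  morphism : ℤ.+-*-rawRing -Raw-AlmostCommutative⟶ fromCommutativeRing R
  morphism = record
    { ⟦_⟧    = embed
    ; +-homo = embed-+
    ; *-homo = embed-*
    ; -‿homo = embed-neg
    ; 0-homo = refl
    ; 1-homo = refl
    }

  open Algebra.Solver.Ring ℤ.+-*-rawRing (fromCommutativeRing R) morphism
    (λ i j → Maybe.map (λ i≡j → reflexive (≡.cong embed i≡j)) (dec⇒weaklyDec ℤ._≟_ i j))
    public

  :0 :1 : ∀ {n} → Polynomial n
  :0 = con (+ 0)
  :1 = con (+ 1)

  -- Its value is definitionally the numeral n of the unoptimised multiplication.
  :ℕ : ∀ {n} → ℕ → Polynomial n
  :ℕ zero    = :0
  :ℕ (suc n) = :1 :+ :ℕ n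

-- Ordered-field arithmetic, absolute value and ceiling

module OrderedField (𝓡 : RealNumbers) where
  open Analysis 𝓡
  open CommutativeRing commutativeRing
    using (refl; sym; trans; +-congˡ; +-congʳ; +-cong; *-congˡ; *-congʳ;
           *-cong; *-comm; *-identityˡ; *-identityʳ; +-identityˡ;
           -‿cong; zeroˡ; zeroʳ) public
  open IsDecTotalOrder isDecTotalOrder public
    using (total; antisym; isPartialOrder)
    renaming (refl to ≤-refl; trans to ≤-trans; reflexive to ≤-reflexive)
  open IntegerCoefficients commutativeRing public
    using (solve; _:=_; _:+_; _:*_; _:-_; :-_; :0; :1; :ℕ)

  poset : Poset _ _ _
  poset = record { isPartialOrder = isPartialOrder }

  open Relation.Binary.Reasoning.PartialOrder poset

  x≤y⇒0≤y-x : ∀ {x y} → x ≤ y → 0# ≤ y - x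
  x≤y⇒0≤y-x {x} {y} x≤y = begin
    0#     ≈⟨ solve 1 (λ x → :0 := x :- x) refl x ⟩
    x - x  ≤⟨ +-monoˡ-≤ (- x) x≤y ⟩
    y - x  ∎

  -- An inequality is certified by writing its defect as a nonnegative expression.
  certify : ∀ {x y e} → 0# ≤ e → e ≈ y - x → x ≤ y
  certify {x} {y} {e} 0≤e e≈ = begin
    x          ≈⟨ +-identityˡ x ⟨
    0# + x     ≤⟨ +-monoˡ-≤ x 0≤e ⟩
    e + x      ≈⟨ +-congʳ e≈ ⟩
    y - x + x  ≈⟨ solve 2 (λ x y → y :- x :+ x := y) refl x y ⟩
    y          ∎

  +-nonNegative : ∀ {x y} → 0# ≤ x → 0# ≤ y → 0# ≤ x + y
  +-nonNegative {x} {y} 0≤x 0≤y = begin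
    0#      ≤⟨ 0≤y ⟩
    y       ≈⟨ +-identityˡ y ⟨
    0# + y  ≤⟨ +-monoˡ-≤ y 0≤x ⟩
    x + y   ∎

  +-mono-≤ : ∀ {x y u v} → x ≤ y → u ≤ v → x + u ≤ y + v
  +-mono-≤ {x} {y} {u} {v} x≤y u≤v =
    certify (+-nonNegative (x≤y⇒0≤y-x x≤y) (x≤y⇒0≤y-x u≤v))
      (solve 4 (λ x y u v → (y :- x) :+ (v :- u) := (y :+ v) :- (x :+ u)) refl x y u v)

  *-monoˡ-≤ : ∀ {z x y} → 0# ≤ z → x ≤ y → z * x ≤ z * y
  *-monoˡ-≤ {z} {x} {y} 0≤z x≤y =
    certify (*-nonNegative 0≤z (x≤y⇒0≤y-x x≤y))
      (solve 3 (λ x y z → z :* (y :- x) := z :* y :- z :* x) refl x y z)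

  *-monoʳ-≤ : ∀ {z x y} → 0# ≤ z → x ≤ y → x * z ≤ y * z
  *-monoʳ-≤ {z} {x} {y} 0≤z x≤y =
    certify (*-nonNegative 0≤z (x≤y⇒0≤y-x x≤y))
      (solve 3 (λ x y z → z :* (y :- x) := y :* z :- x :* z) refl x y z)

  x≤0⇒0≤-x : ∀ {x} → x ≤ 0# → 0# ≤ - x
  x≤0⇒0≤-x {x} x≤0 = certify (x≤y⇒0≤y-x x≤0) (solve 1 (λ x → :0 :- x := :- x :- :0) refl x)

  square-nonNegative : ∀ x → 0# ≤ x * x
  square-nonNegative x with total 0# x
  ... | inj₁ 0≤x = *-nonNegative 0≤x 0≤x
  ... | inj₂ x≤0 = ≤-trans (*-nonNegative (x≤0⇒0≤-x x≤0) (x≤0⇒0≤-x x≤0))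
    (≤-reflexive (solve 1 (λ x → (:- x) :* (:- x) := x :* x) refl x))

  0≤1 : 0# ≤ 1#
  0≤1 = ≤-trans (square-nonNegative 1#) (≤-reflexive (*-identityˡ 1#))

  0<1 : 0# < 1#
  0<1 = 0≤1 , λ 0≈1 → 1≉0 (sym 0≈1)

  1≰0 : ¬ (1# ≤ 0#)
  1≰0 1≤0 = 1≉0 (antisym 1≤0 0≤1)

  ≰⇒≥ : ∀ {x y} → ¬ (x ≤ y) → y ≤ x
  ≰⇒≥ {x} {y} x≰y with total x y
  ... | inj₁ x≤y = ⊥-elim (x≰y x≤y)
  ... | inj₂ y≤x = y≤x

  ≰0⇒0< : ∀ {x} → ¬ (x ≤ 0#) → 0# < x
  ≰0⇒0< x≰0 = ≰⇒≥ x≰0 , λ 0≈x → x≰0 (≤-reflexive (sym 0≈x))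

  <-≤-trans : ∀ {x y} → 0# < x → x ≤ y → 0# < y
  <-≤-trans (0≤x , 0≉x) x≤y =
    ≤-trans 0≤x x≤y , λ 0≈y → 0≉x (antisym 0≤x (≤-trans x≤y (≤-reflexive (sym 0≈y))))

  1≤⇒0< : ∀ {x} → 1# ≤ x → 0# < x
  1≤⇒0< = <-≤-trans 0<1

  ≰⇒0<- : ∀ {x y} → ¬ (y ≤ x) → 0# < y - x
  ≰⇒0<- {x} {y} y≰x = x≤y⇒0≤y-x (≰⇒≥ y≰x) ,
    λ 0≈y-x → y≰x (certify ≤-refl (trans 0≈y-x (sym (trans
      (solve 2 (λ x y → x :- y := :- (y :- x)) refl x y)
      (trans (-‿cong (sym 0≈y-x)) (trans (solve 0 (:- :0 := :0) refl) 0≈y-x))))))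

  *-inverseʳ : ∀ {x} → 0# < x → x * x ⁻¹ ≈ 1#
  *-inverseʳ {x} (_ , 0≉x) = ⁻¹-inverseʳ x (λ x≈0 → 0≉x (sym x≈0))

  ⁻¹-nonNegative : ∀ {x} → 0# < x → 0# ≤ x ⁻¹
  ⁻¹-nonNegative {x} 0<x with total 0# (x ⁻¹)
  ... | inj₁ 0≤x⁻¹ = 0≤x⁻¹
  ... | inj₂ x⁻¹≤0 = ⊥-elim (1≰0 (certify
    (*-nonNegative (proj₁ 0<x) (x≤0⇒0≤-x x⁻¹≤0))
    (trans (solve 2 (λ x i → x :* (:- i) := :0 :- x :* i) refl x (x ⁻¹))
           (+-congˡ (-‿cong (*-inverseʳ 0<x))))))

  0≤*-cancelˡ : ∀ {c x} → 0# < c → 0# ≤ c * x → 0# ≤ x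
  0≤*-cancelˡ {c} {x} 0<c 0≤cx = begin
    0#                ≤⟨ *-nonNegative (⁻¹-nonNegative 0<c) 0≤cx ⟩
    c ⁻¹ * (c * x)    ≈⟨ solve 3 (λ c i x → i :* (c :* x) := (c :* i) :* x) refl c (c ⁻¹) x ⟩
    c * c ⁻¹ * x      ≈⟨ *-congʳ (*-inverseʳ 0<c) ⟩
    1# * x            ≈⟨ *-identityˡ x ⟩
    x                 ∎

  *-cancelˡ-≤ : ∀ {c x y} → 0# < c → c * x ≤ c * y → x ≤ y
  *-cancelˡ-≤ {c} {x} {y} 0<c cx≤cy = certify
    (0≤*-cancelˡ 0<c (≤-trans (x≤y⇒0≤y-x cx≤cy)
      (≤-reflexive (solve 3 (λ c x y → c :* y :- c :* x := c :* (y :- x)) refl c x y))))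
    refl

  *-cancelˡ-≈ : ∀ {c x y} → 0# < c → c * x ≈ c * y → x ≈ y
  *-cancelˡ-≈ 0<c cx≈cy = antisym (*-cancelˡ-≤ 0<c (≤-reflexive cx≈cy))
                                  (*-cancelˡ-≤ 0<c (≤-reflexive (sym cx≈cy)))

  *-positive : ∀ {x y} → 0# < x → 0# < y → 0# < x * y
  *-positive {x} {y} 0<x (0≤y , 0≉y) = *-nonNegative (proj₁ 0<x) 0≤y ,
    λ 0≈xy → 0≉y (*-cancelˡ-≈ 0<x (trans (zeroʳ x) 0≈xy))

  ⁻¹-positive : ∀ {x} → 0# < x → 0# < x ⁻¹
  ⁻¹-positive {x} 0<x = ⁻¹-nonNegative 0<x ,
    λ 0≈x⁻¹ → 1≉0 (trans (sym (*-inverseʳ 0<x)) (trans (*-congˡ (sym 0≈x⁻¹)) (zeroʳ x)))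

  [x/y]*y≈x : ∀ {x y} → 0# < y → x / y * y ≈ x
  [x/y]*y≈x {x} {y} 0<y = trans
    (solve 3 (λ x y i → x :* i :* y := x :* (y :* i)) refl x y (y ⁻¹))
    (trans (*-congˡ (*-inverseʳ 0<y)) (*-identityʳ x))

  -- In the case to be excluded, `x + y ≥ x - y > 0`, and this positive factor can be cancelled from
  -- `(x + y) * (y - x) ≥ 0`.
  square-cancel-≤ : ∀ {x y} → 0# ≤ y → x * x ≤ y * y → x ≤ y
  square-cancel-≤ {x} {y} 0≤y x²≤y² with x ≤? y
  ... | yes x≤y = x≤y
  ... | no  x≰y = ⊥-elim (x≰y (certify (0≤*-cancelˡ 0<x+y 0≤[x+y][y-x]) refl))
    where
    0<x+y : 0# < x + y
    0<x+y = <-≤-trans (≰⇒0<- x≰y) (certify (+-nonNegative 0≤y 0≤y)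
      (solve 2 (λ x y → y :+ y := (x :+ y) :- (x :- y)) refl x y))
    0≤[x+y][y-x] : 0# ≤ (x + y) * (y - x)
    0≤[x+y][y-x] = ≤-trans (x≤y⇒0≤y-x x²≤y²) (≤-reflexive
      (solve 2 (λ x y → y :* y :- x :* x := (x :+ y) :* (y :- x)) refl x y))

  fromℕ-nonNegative : ∀ n → 0# ≤ fromℕ n
  fromℕ-nonNegative zero    = ≤-refl
  fromℕ-nonNegative (suc n) = +-nonNegative 0≤1 (fromℕ-nonNegative n)

  fromℕ-positive : ∀ n → 0# < fromℕ (suc n)
  fromℕ-positive n = 1≤⇒0< (certify (fromℕ-nonNegative n)
    (solve 1 (λ n → n := (:1 :+ n) :- :1) refl (fromℕ n)))

  fromℕ-mono-≤ : ∀ {m n} → m ℕ.≤ n → fromℕ m ≤ fromℕ n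
  fromℕ-mono-≤ {n = n} ℕ.z≤n = fromℕ-nonNegative n
  fromℕ-mono-≤ (ℕ.s≤s m≤n) = +-mono-≤ ≤-refl (fromℕ-mono-≤ m≤n)

  x≤∣x∣ : ∀ x → x ≤ ∣ x ∣
  x≤∣x∣ x with 0# ≤? x
  ... | yes _   = ≤-refl
  ... | no  0≰x = ≤-trans (≰⇒≥ 0≰x) (x≤0⇒0≤-x (≰⇒≥ 0≰x))

  ∣x∣≤ : ∀ {x c} → x ≤ c → - c ≤ x → ∣ x ∣ ≤ c
  ∣x∣≤ {x} {c} x≤c -c≤x with 0# ≤? x
  ... | yes _ = x≤c
  ... | no  _ = certify (x≤y⇒0≤y-x -c≤x) (solve 2 (λ x c → x :- (:- c) := c :- (:- x)) refl x c)

  ceilBelow-upper : ∀ x m → x ≤ fromℕ m → x ≤ fromℕ (ceilBelow x m)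
  ceilBelow-upper x zero    x≤0 = x≤0
  ceilBelow-upper x (suc m) x≤1+m with x ≤? fromℕ m
  ... | yes x≤m = ceilBelow-upper x m x≤m
  ... | no  _   = x≤1+m

  -- The search runs downwards and stops at `suc m` exactly when the test `x ≤ fromℕ m` fails; that
  -- failure is the evidence returned.
  ceilBelow-least : ∀ x m {k} → ceilBelow x m ≡ suc k → ¬ (x ≤ fromℕ k)
  ceilBelow-least x (suc m) eq with x ≤? fromℕ m
  ... | yes _   = ceilBelow-least x m eq
  ceilBelow-least x (suc m) ≡.refl | no x≰m = x≰m

  ⌈⌉-upper : ∀ x → x ≤ fromℕ ⌈ x ⌉
  ⌈⌉-upper x = ceilBelow-upper x (proj₁ (archimedean x)) (proj₂ (archimedean x))

  ⌈⌉-least : ∀ x {k} → ⌈ x ⌉ ≡ suc k → ¬ (x ≤ fromℕ k)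
  ⌈⌉-least x = ceilBelow-least x (proj₁ (archimedean x))

-- Square roots as suprema

module SquareRoot (𝓡 : RealNumbers) where
  open Analysis 𝓡
  open OrderedField 𝓡
  open Relation.Binary.Reasoning.PartialOrder poset

  module _ {x : ℝ} (0≤x : 0# ≤ x) where
    private
      s w : ℝ
      s = √ x
      -- Unlike `x` itself, `x + 1#` has square at least `x` also when `x` is below 1.
      w = x + 1#

      w²-x : 0# ≤ w * w - x
      w²-x = ≤-trans (+-nonNegative (+-nonNegative (square-nonNegative x) 0≤x) 0≤1)
        (≤-reflexive (solve 1 (λ x → x :* x :+ x :+ :1 := (x :+ :1) :* (x :+ :1) :- x) refl x))

      0≤w : 0# ≤ w
      0≤w = +-nonNegative 0≤x 0≤1

      inhabited : ∃[ y ] y * y ≤ x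
      inhabited = 0# , ≤-trans (≤-reflexive (zeroˡ 0#)) 0≤x

      bounded : ∃[ u ] IsUpperBound (λ y → y * y ≤ x) u
      bounded = w , λ y y²≤x → square-cancel-≤ 0≤w (≤-trans y²≤x (certify w²-x refl))

    √-nonNegative : 0# ≤ s
    √-nonNegative = sup-upper _ inhabited bounded 0# (proj₂ inhabited)

    -- The Newton iterate (s² + x) / 2s is an upper bound.
    √-square-≤ : s * s ≤ x
    √-square-≤ with s ≤? 0#
    ... | yes s≤0 = ≤-trans (≤-reflexive s²≈0) 0≤x
      where
      s²≈0 : s * s ≈ 0#
      s²≈0 = trans (*-congˡ (antisym s≤0 √-nonNegative)) (zeroʳ s)
    ... | no s≰0 = certify (x≤y⇒0≤y-x 2ss≤s²+x)
      (solve 2 (λ s x → (s :* s :+ x) :- (s :+ s) :* s := x :- s :* s) refl s x)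
      where
      0<2s : 0# < s + s
      0<2s = <-≤-trans (≰0⇒0< s≰0) (certify √-nonNegative
        (solve 1 (λ s → s := (s :+ s) :- s) refl s))
      newton : ℝ
      newton = (s * s + x) / (s + s)
      2s*newton : (s + s) * newton ≈ s * s + x
      2s*newton = trans (*-comm _ _) ([x/y]*y≈x 0<2s)
      newton-upper : IsUpperBound (λ y → y * y ≤ x) newton
      newton-upper y y²≤x = *-cancelˡ-≤ 0<2s (≤-trans
        (certify (+-nonNegative (square-nonNegative (s - y)) (x≤y⇒0≤y-x y²≤x))
          (solve 3 (λ s x y → (s :- y) :* (s :- y) :+ (x :- y :* y)
                              := (s :* s :+ x) :- (s :+ s) :* y) refl s x y))
        (≤-reflexive (sym 2s*newton)))
      2ss≤s²+x : (s + s) * s ≤ s * s + x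
      2ss≤s²+x = ≤-trans
        (*-monoˡ-≤ (proj₁ 0<2s) (sup-least _ inhabited bounded newton newton-upper))
        (≤-reflexive 2s*newton)

    -- The secant step (s w + x) / (s + w) from s and w still has square at most x.
    √-square-≥ : x ≤ s * s
    √-square-≥ with x ≤? s * s
    ... | yes x≤s² = x≤s²
    ... | no  x≰s² = certify (x≤y⇒0≤y-x sw+x≤[s+w]s)
      (solve 3 (λ s w x → (s :+ w) :* s :- (s :* w :+ x) := s :* s :- x) refl s w x)
      where
      0<s+w : 0# < s + w
      0<s+w = 1≤⇒0< (certify (+-nonNegative √-nonNegative 0≤x)
        (solve 2 (λ s x → s :+ x := (s :+ (x :+ :1)) :- :1) refl s x))
      secant : ℝ
      secant = (s * w + x) / (s + w)
      [s+w]*secant : (s + w) * secant ≈ s * w + x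
      [s+w]*secant = trans (*-comm _ _) ([x/y]*y≈x 0<s+w)
      secant² : secant * secant ≤ x
      secant² = *-cancelˡ-≤ (*-positive 0<s+w 0<s+w) (begin
        (s + w) * (s + w) * (secant * secant)
          ≈⟨ solve 2 (λ d y → d :* d :* (y :* y) := (d :* y) :* (d :* y)) refl (s + w) secant ⟩
        ((s + w) * secant) * ((s + w) * secant)
          ≈⟨ *-cong [s+w]*secant [s+w]*secant ⟩
        (s * w + x) * (s * w + x)
          -- The defect factors because `x` lies between `s * s` and `w * w`; the first of these
          -- bounds is the case assumption.
          ≤⟨ certify (*-nonNegative (x≤y⇒0≤y-x (≰⇒≥ x≰s²)) w²-x)
               (solve 3 (λ s w x → (x :- s :* s) :* (w :* w :- x)
                 := (s :+ w) :* (s :+ w) :* x :- (s :* w :+ x) :* (s :* w :+ x)) refl s w x) ⟩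
        (s + w) * (s + w) * x  ∎)
      sw+x≤[s+w]s : s * w + x ≤ (s + w) * s
      sw+x≤[s+w]s = ≤-trans (≤-reflexive (sym [s+w]*secant))
        (*-monoˡ-≤ (proj₁ 0<s+w) (sup-upper _ inhabited bounded secant secant²))

    √-square : s * s ≈ x
    √-square = antisym √-square-≤ √-square-≥

-- The exponential series at nonnegative arguments

module Exponential (𝓡 : RealNumbers) where
  open Analysis 𝓡
  open OrderedField 𝓡
  open Relation.Binary.Reasoning.PartialOrder poset
  open Algebra.Properties.Semiring.Mult semiring using (×1-homo-*)

  term : ℝ → ℕ → ℝ
  term y k = y ^ k / fromℕ (k !)

  partialSum : ℝ → ℕ → ℝ
  partialSum y N = sum {N} (λ k → term y (toℕ k))

  -- `sum` unfolds at its first summand, whereas comparing consecutive partial sums needs the last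
  -- one; the induction shifts `g`.
  sum-snoc : ∀ (g : ℕ → ℝ) N →
             sum {suc N} (λ k → g (toℕ k)) ≈ sum {N} (λ k → g (toℕ k)) + g N
  sum-snoc g zero    = solve 1 (λ a → a :+ :0 := :0 :+ a) refl (g 0)
  sum-snoc g (suc N) = trans (+-congˡ (sum-snoc (λ k → g (suc k)) N))
    (solve 3 (λ a b c → a :+ (b :+ c) := a :+ b :+ c) refl
      (g 0) (sum {N} (λ k → g (suc (toℕ k)))) (g (suc N)))

  term-zero : ∀ y → term y 0 ≈ 1#
  term-zero y = *-cancelˡ-≈ (fromℕ-positive 0) (trans
    (solve 2 (λ c i → c :* (:1 :* i) := c :* i) refl (fromℕ 1) (fromℕ 1 ⁻¹))
    (trans (*-inverseʳ (fromℕ-positive 0)) (solve 0 (:1 := (:1 :+ :0) :* :1) refl)))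

  fromℕ-!-positive : ∀ k → 0# < fromℕ (k !)
  fromℕ-!-positive k = <-≤-trans (fromℕ-positive 0) (fromℕ-mono-≤ (ℕ.1≤n! k))

  -- Together with `term-zero` this recurrence stands in for the powers and factorials: the later
  -- estimates of terms use only these two facts.
  term-suc : ∀ y k → fromℕ (suc k) * term y (suc k) ≈ y * term y k
  term-suc y k = *-cancelˡ-≈ (fromℕ-!-positive k) (begin-equality
    F * (c * (y * z * F′ ⁻¹))
      ≈⟨ solve 5 (λ F c y z i → F :* (c :* (y :* z :* i)) := y :* z :* ((c :* F) :* i)) refl
           F c y z (F′ ⁻¹) ⟩
    y * z * (c * F * F′ ⁻¹)
      ≈⟨ *-congˡ (*-congʳ (×1-homo-* (suc k) (k !))) ⟨
    y * z * (F′ * F′ ⁻¹)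
      ≈⟨ *-congˡ (trans (*-inverseʳ (fromℕ-!-positive (suc k)))
                        (sym (*-inverseʳ (fromℕ-!-positive k)))) ⟩
    y * z * (F * F ⁻¹)
      ≈⟨ solve 4 (λ F y z i → y :* z :* (F :* i) := F :* (y :* (z :* i))) refl
           F y z (F ⁻¹) ⟩
    F * (y * (z * F ⁻¹)) ∎)
    where
    F F′ c z : ℝ
    F  = fromℕ (k !)
    F′ = fromℕ (suc k !)
    c  = fromℕ (suc k)
    z  = y ^ k

  module _ {y : ℝ} (0≤y : 0# ≤ y) where

    term-nonNegative : ∀ k → 0# ≤ term y k
    term-nonNegative zero    = ≤-trans 0≤1 (≤-reflexive (sym (term-zero y)))
    term-nonNegative (suc k) = 0≤*-cancelˡ (fromℕ-positive k)
      (≤-trans (*-nonNegative 0≤y (term-nonNegative k)) (≤-reflexive (sym (term-suc y k))))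

    partialSum-step : ∀ N → partialSum y N ≤ partialSum y (suc N)
    partialSum-step N = certify (term-nonNegative N)
      (trans (solve 2 (λ p t → t := p :+ t :- p) refl (partialSum y N) (term y N))
             (+-congʳ (sym (sum-snoc (term y) N))))

    partialSum-mono : ∀ N j → partialSum y N ≤ partialSum y (j ℕ.+ N)
    partialSum-mono N zero    = ≤-refl
    partialSum-mono N (suc j) = ≤-trans (partialSum-mono N j) (partialSum-step (j ℕ.+ N))

    partialSum-mono-≤ : ∀ {M N} → M ℕ.≤ N → partialSum y M ≤ partialSum y N
    partialSum-mono-≤ {M} {N} M≤N =
      ≡.subst (λ n → partialSum y M ≤ partialSum y n) (ℕ.m∸n+n≡m M≤N)
        (partialSum-mono M (N ℕ.∸ M))

    private
      M : ℕ
      M = proj₁ (archimedean (fromℕ 2 * y))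

      -- From M ≥ 2y on the terms at least halve.
      majorant : ℕ → ℝ
      majorant N = partialSum y N + fromℕ 2 * term y N

      -- The reserve `2 t` is the geometric tail `t + t/2 + t/4 + ...`. A step moves `t` into the
      -- sum and leaves the reserve `2 t′`, where `2 t′ ≤ t` because `c t′ = y t` and `c ≥ 2 y`.
      majorant-step : ∀ {N} → M ℕ.≤ N → majorant (suc N) ≤ majorant N
      majorant-step {N} M≤N = *-cancelˡ-≤ (fromℕ-positive N) (begin
        c * (partialSum y (suc N) + fromℕ 2 * t′)
          ≈⟨ *-congˡ (+-congʳ (sum-snoc (term y) N)) ⟩
        c * (p + t + fromℕ 2 * t′)
          ≈⟨ solve 4 (λ c p t t′ → c :* (p :+ t :+ :ℕ 2 :* t′)
               := c :* (p :+ t) :+ :ℕ 2 :* (c :* t′)) refl c p t t′ ⟩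
        c * (p + t) + fromℕ 2 * (c * t′)
          ≈⟨ +-congˡ (*-congˡ (term-suc y N)) ⟩
        c * (p + t) + fromℕ 2 * (y * t)
          ≤⟨ certify (*-nonNegative 0≤c-2y (term-nonNegative N))
               (solve 4 (λ c p t y → (c :- :ℕ 2 :* y) :* t
                  := c :* (p :+ :ℕ 2 :* t) :- (c :* (p :+ t) :+ :ℕ 2 :* (y :* t))) refl c p t y) ⟩
        c * (p + fromℕ 2 * t) ∎)
        where
        c p t t′ : ℝ
        c  = fromℕ (suc N)
        p  = partialSum y N
        t  = term y N
        t′ = term y (suc N)
        0≤c-2y : 0# ≤ c - fromℕ 2 * y
        0≤c-2y = x≤y⇒0≤y-x (≤-trans (proj₂ (archimedean (fromℕ 2 * y)))
          (fromℕ-mono-≤ (ℕ.≤-trans M≤N (ℕ.n≤1+n N))))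

      majorant-antitone : ∀ j → majorant (j ℕ.+ M) ≤ majorant M
      majorant-antitone zero    = ≤-refl
      majorant-antitone (suc j) =
        ≤-trans (majorant-step (ℕ.m≤n+m M j)) (majorant-antitone j)

      partialSum-bounded : ∀ N → partialSum y N ≤ majorant M
      partialSum-bounded N = begin
        partialSum y N          ≤⟨ partialSum-mono-≤ (ℕ.m≤m+n N M) ⟩
        partialSum y (N ℕ.+ M)
          ≤⟨ certify (*-nonNegative (fromℕ-nonNegative 2) (term-nonNegative (N ℕ.+ M)))
               (solve 2 (λ p t → t := (p :+ t) :- p) refl
                  (partialSum y (N ℕ.+ M)) (fromℕ 2 * term y (N ℕ.+ M))) ⟩
        majorant (N ℕ.+ M)      ≤⟨ majorant-antitone N ⟩
        majorant M              ∎

      -- This is the set whose supremum `lim` takes. Since the partial sums increase, each of them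
      -- belongs to it, and their upper bounds are its upper bounds.
      EventuallyBelow : ℝ → Set
      EventuallyBelow z = ∃[ N ] (∀ n → N ℕ.≤ n → z ≤ partialSum y n)

      upper : ∀ u → (∀ N → partialSum y N ≤ u) → IsUpperBound EventuallyBelow u
      upper u sums≤u z (N , z≤) = ≤-trans (z≤ N ℕ.≤-refl) (sums≤u N)

      below : ∀ N → EventuallyBelow (partialSum y N)
      below N = N , λ _ → partialSum-mono-≤

      inhabited : ∃[ z ] EventuallyBelow z
      inhabited = partialSum y 0 , below 0

      bounded : ∃[ u ] IsUpperBound EventuallyBelow u
      bounded = majorant M , upper (majorant M) partialSum-bounded

    partialSum≤exp : ∀ N → partialSum y N ≤ exp y
    partialSum≤exp N = sup-upper EventuallyBelow inhabited bounded (partialSum y N) (below N)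

    exp-least : ∀ {u} → (∀ N → partialSum y N ≤ u) → exp y ≤ u
    exp-least {u} sums≤u = sup-least EventuallyBelow inhabited bounded u (upper u sums≤u)

    -- The first two terms already sum to `1# + y`. This crude bound is what makes the set defining
    -- `log` bounded.
    y≤exp : y ≤ exp y
    y≤exp = ≤-trans (certify 0≤1 (trans
      (solve 1 (λ y → :1 := :0 :+ :1 :+ y :- y) refl y) (+-congʳ (sym sum₂))))
      (partialSum≤exp 2)
      where
      term-one : term y 1 ≈ y
      term-one = *-cancelˡ-≈ (fromℕ-positive 0) (trans (term-suc y 0) (trans
        (*-congˡ (term-zero y)) (solve 1 (λ y → y :* :1 := :ℕ 1 :* y) refl y)))
      sum₂ : partialSum y 2 ≈ 0# + 1# + y
      sum₂ = trans (sum-snoc (term y) 1)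
        (+-cong (trans (sum-snoc (term y) 0) (+-congˡ (term-zero y))) term-one)

  -- Stating `y ≈ z + δ` as an equation lets `y` be any given point, as in `log-growth`, where the
  -- points are `z - δ` and `z`; `exp` is then never transported along `≈`.
  module _ {z δ y : ℝ} (0≤z : 0# ≤ z) (0≤δ : 0# ≤ δ) (y≈z+δ : y ≈ z + δ) where
    private
      0≤y : 0# ≤ y
      0≤y = ≤-trans (+-nonNegative 0≤z 0≤δ) (≤-reflexive (sym y≈z+δ))

    -- The left side consists of the first two binomial terms of `(z + δ)^(k+1) / (k+1)!`. The
    -- induction goes through the recurrence and drops `δ * (δ * term z k)`.
    term-growth : ∀ k → term z (suc k) + δ * term z k ≤ term y (suc k)
    term-growth zero = *-cancelˡ-≤ (fromℕ-positive 0) (≤-reflexive (begin-equality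
      fromℕ 1 * (term z 1 + δ * term z 0)
        ≈⟨ solve 4 (λ c a d b → c :* (a :+ d :* b) := c :* a :+ c :* (d :* b)) refl
             (fromℕ 1) (term z 1) δ (term z 0) ⟩
      fromℕ 1 * term z 1 + fromℕ 1 * (δ * term z 0)
        ≈⟨ +-cong (trans (term-suc z 0) (*-congˡ (term-zero z)))
                  (*-congˡ (*-congˡ (term-zero z))) ⟩
      z * 1# + fromℕ 1 * (δ * 1#)
        ≈⟨ solve 2 (λ z d → z :* :1 :+ :ℕ 1 :* (d :* :1) := (z :+ d) :* :1) refl z δ ⟩
      (z + δ) * 1#        ≈⟨ *-cong y≈z+δ (term-zero y) ⟨
      y * term y 0        ≈⟨ term-suc y 0 ⟨
      fromℕ 1 * term y 1  ∎))
    term-growth (suc k) = *-cancelˡ-≤ (fromℕ-positive (suc k)) (begin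
      fromℕ (suc (suc k)) * (a₂ + δ * a₁)
        -- The factor `1 + c` is split only on `a₁`, whose own recurrence carries the factor `c`.
        ≈⟨ solve 4 (λ c a₂ d a₁ → (:1 :+ c) :* (a₂ :+ d :* a₁)
             := (:1 :+ c) :* a₂ :+ (d :* a₁ :+ d :* (c :* a₁))) refl c a₂ δ a₁ ⟩
      fromℕ (suc (suc k)) * a₂ + (δ * a₁ + δ * (c * a₁))
        ≈⟨ +-cong (term-suc z (suc k)) (+-congˡ (*-congˡ (term-suc z k))) ⟩
      z * a₁ + (δ * a₁ + δ * (z * a₀))
        ≤⟨ certify (*-nonNegative 0≤δ (*-nonNegative 0≤δ (term-nonNegative 0≤z k)))
             (solve 4 (λ z d a₁ a₀ → d :* (d :* a₀)
                := (z :+ d) :* (a₁ :+ d :* a₀) :- (z :* a₁ :+ (d :* a₁ :+ d :* (z :* a₀))))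
                refl z δ a₁ a₀) ⟩
      (z + δ) * (a₁ + δ * a₀)   ≈⟨ *-congʳ y≈z+δ ⟨
      y * (a₁ + δ * a₀)         ≤⟨ *-monoˡ-≤ 0≤y (term-growth k) ⟩
      y * term y (suc k)        ≈⟨ term-suc y (suc k) ⟨
      fromℕ (suc (suc k)) * term y (suc (suc k)) ∎)
      where
      a₀ a₁ a₂ c : ℝ
      a₀ = term z k
      a₁ = term z (suc k)
      a₂ = term z (suc (suc k))
      c  = fromℕ (suc k)

    -- Summing `term-growth` pairs `δ * term z k` with `term z (suc k)`, so the sum multiplied by
    -- `δ` is one term shorter; the constant terms agree.
    partialSum-growth : ∀ N → partialSum z (suc N) + δ * partialSum z N ≤ partialSum y (suc N)
    partialSum-growth zero = ≤-reflexive (trans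
      (+-congʳ (+-congʳ (trans (term-zero z) (sym (term-zero y)))))
      (solve 2 (λ t d → t :+ :0 :+ d :* :0 := t :+ :0) refl (term y 0) δ))
    partialSum-growth (suc N) = begin
      partialSum z (suc (suc N)) + δ * partialSum z (suc N)
        ≈⟨ +-cong (sum-snoc (term z) (suc N)) (*-congˡ (sum-snoc (term z) N)) ⟩
      p′ + term z (suc N) + δ * (p + term z N)
        ≈⟨ solve 5 (λ p′ t′ d p t → p′ :+ t′ :+ d :* (p :+ t) := (p′ :+ d :* p) :+ (t′ :+ d :* t))
             refl p′ (term z (suc N)) δ p (term z N) ⟩
      (p′ + δ * p) + (term z (suc N) + δ * term z N)
        ≤⟨ +-mono-≤ (partialSum-growth N) (term-growth N) ⟩
      partialSum y (suc N) + term y (suc N)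
        ≈⟨ sum-snoc (term y) (suc N) ⟨
      partialSum y (suc (suc N)) ∎
      where
      p p′ : ℝ
      p  = partialSum z N
      p′ = partialSum z (suc N)

    exp-growth : exp z * (1# + δ) ≤ exp y
    exp-growth = begin
      -- As `exp z` is a supremum, the factor is first moved across: `exp y / (1# + δ)` bounds every
      -- partial sum at `z`.
      exp z * (1# + δ)                ≤⟨ *-monoʳ-≤ (proj₁ 0<1+δ) (exp-least 0≤z sums≤) ⟩
      exp y / (1# + δ) * (1# + δ)     ≈⟨ [x/y]*y≈x 0<1+δ ⟩
      exp y                           ∎
      where
      0<1+δ : 0# < 1# + δ
      0<1+δ = 1≤⇒0< (certify 0≤δ (solve 1 (λ d → d := (:1 :+ d) :- :1) refl δ))
      sums≤ : ∀ N → partialSum z N ≤ exp y / (1# + δ)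
      sums≤ N = *-cancelˡ-≤ 0<1+δ (begin
        (1# + δ) * partialSum z N
          ≈⟨ solve 2 (λ d p → (:1 :+ d) :* p := p :+ d :* p) refl δ (partialSum z N) ⟩
        partialSum z N + δ * partialSum z N
          ≤⟨ +-mono-≤ (partialSum-step 0≤z N) ≤-refl ⟩
        partialSum z (suc N) + δ * partialSum z N
          ≤⟨ partialSum-growth N ⟩
        partialSum y (suc N)
          ≤⟨ partialSum≤exp 0≤y (suc N) ⟩
        exp y
          ≈⟨ [x/y]*y≈x 0<1+δ ⟨
        exp y / (1# + δ) * (1# + δ)
          ≈⟨ *-comm _ _ ⟩
        (1# + δ) * (exp y / (1# + δ)) ∎)

-- The logarithm from `exp 1#` on

module Logarithm (𝓡 : RealNumbers) where
  open Analysis 𝓡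
  open OrderedField 𝓡
  open Exponential 𝓡 using (y≤exp; exp-growth)
  open Relation.Binary.Reasoning.PartialOrder poset

  1≤exp1 : 1# ≤ exp 1#
  1≤exp1 = y≤exp 0≤1

  module _ {x : ℝ} (e≤x : exp 1# ≤ x) where
    private
      0≤x : 0# ≤ x
      0≤x = ≤-trans 0≤1 (≤-trans 1≤exp1 e≤x)

      inhabited : ∃[ y ] exp y ≤ x
      inhabited = 1# , e≤x

      bounded : ∃[ u ] IsUpperBound (λ y → exp y ≤ x) u
      bounded = x , bound
        where
        bound : IsUpperBound (λ y → exp y ≤ x) x
        bound y eʸ≤x with total 0# y
        ... | inj₁ 0≤y = ≤-trans (y≤exp 0≤y) eʸ≤x
        -- Negative `y` are bounded by their sign alone, without any estimate of `exp` there.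
        ... | inj₂ y≤0 = ≤-trans y≤0 0≤x

    log-upper : ∀ {y} → exp y ≤ x → y ≤ log x
    log-upper {y} = sup-upper (λ y → exp y ≤ x) inhabited bounded y

    log-least : ∀ {u} → (∀ y → exp y ≤ x → y ≤ u) → log x ≤ u
    log-least {u} = sup-least (λ y → exp y ≤ x) inhabited bounded u

    -- The threshold `exp 1#` places `1#` in the set defining the logarithm, which is thereby
    -- inhabited as well.
    1≤log : 1# ≤ log x
    1≤log = log-upper e≤x

  log-mono : ∀ {x y} → exp 1# ≤ x → x ≤ y → log x ≤ log y
  log-mono e≤x x≤y = log-least e≤x λ z eᶻ≤x → log-upper (≤-trans e≤x x≤y) (≤-trans eᶻ≤x x≤y)

  -- A stand-in for `log (1 + δ) ≤ δ`: each `z` competing for `log y` is lowered by `δ` to compete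
  -- for `log x`. `exp-growth` needs `z - δ` nonnegative; a smaller `z` is below `δ`, and `log x` is
  -- nonnegative.
  log-growth : ∀ {x y δ} → exp 1# ≤ x → x ≤ y → 0# ≤ δ → y ≤ x * (1# + δ) → log y ≤ log x + δ
  log-growth {x} {y} {δ} e≤x x≤y 0≤δ y≤ = log-least (≤-trans e≤x x≤y) bound
    where
    0<1+δ : 0# < 1# + δ
    0<1+δ = 1≤⇒0< (certify 0≤δ (solve 1 (λ d → d := (:1 :+ d) :- :1) refl δ))
    bound : ∀ z → exp z ≤ y → z ≤ log x + δ
    bound z eᶻ≤y with total δ z
    ... | inj₁ δ≤z = certify (x≤y⇒0≤y-x (log-upper e≤x exp[z-δ]≤x))
      (solve 3 (λ z d l → l :- (z :- d) := (l :+ d) :- z) refl z δ (log x))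
      where
      exp[z-δ]≤x : exp (z - δ) ≤ x
      exp[z-δ]≤x = *-cancelˡ-≤ 0<1+δ (begin
        (1# + δ) * exp (z - δ)  ≈⟨ *-comm _ _ ⟩
        exp (z - δ) * (1# + δ)
          ≤⟨ exp-growth (x≤y⇒0≤y-x δ≤z) 0≤δ (solve 2 (λ z d → z := z :- d :+ d) refl z δ) ⟩
        exp z                   ≤⟨ eᶻ≤y ⟩
        y                       ≤⟨ y≤ ⟩
        x * (1# + δ)            ≈⟨ *-comm _ _ ⟩
        (1# + δ) * x            ∎)
    ... | inj₂ z≤δ = begin
      z          ≤⟨ z≤δ ⟩
      δ          ≈⟨ +-identityˡ δ ⟨
      0# + δ     ≤⟨ +-mono-≤ (≤-trans 0≤1 (1≤log e≤x)) ≤-refl ⟩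
      log x + δ  ∎

-- Comparison of `q` with its main term

module Quotient (𝓡 : RealNumbers) (ℓ : ℕ) (1≤ℓ : 1 ℕ.≤ ℓ) where
  open Analysis 𝓡
  open OrderedField 𝓡
  open SquareRoot 𝓡
  open Logarithm 𝓡
  open Relation.Binary.Reasoning.PartialOrder poset

  private
    l c κ : ℝ
    l = fromℕ ℓ
    c = l - fromℕ 2
    -- Half of `l + (l + 2)`: the index costs `2 H ≤ R + l`, and the discriminant costs
    -- `R ≤ 2 W + (l + 2)`.
    κ = l + 1#

    1≤l : 1# ≤ l
    1≤l = ≤-trans (≤-reflexive (solve 0 (:1 := :ℕ 1) refl)) (fromℕ-mono-≤ 1≤ℓ)

    0<l : 0# < l
    0<l = 1≤⇒0< 1≤l

    0≤l : 0# ≤ l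
    0≤l = proj₁ 0<l

    0≤κ : 0# ≤ κ
    0≤κ = +-nonNegative 0≤l 0≤1

    half : ℝ
    half = fromℕ 2 ⁻¹

    2*half : fromℕ 2 * half ≈ 1#
    2*half = *-inverseʳ (fromℕ-positive 1)

  h-value : ∀ m → h ℓ m ≈ 1# + l * fromℕ m
  h-value m = trans
    (solve 3 (λ l m i →
        (:1 :+ m) :* (l :* (:1 :+ m :- :1) :+ :ℕ 2) :* i :- m :* (l :* (m :- :1) :+ :ℕ 2) :* i
        := (:1 :+ l :* m) :* (:ℕ 2 :* i)) refl l (fromℕ m) half)
    (trans (*-congˡ 2*half) (*-identityʳ _))

  -- This is (2 ℓ n - ℓ + 2)² = 8 ℓ L_n + (ℓ - 2)² for n = m + 1.
  L-square : ∀ m → fromℕ 8 * l * L ℓ (suc m) + c * c ≈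
    (fromℕ 2 * (1# + l * fromℕ m) + l) * (fromℕ 2 * (1# + l * fromℕ m) + l)
  L-square m = trans (+-congʳ (trans
      (solve 3 (λ l m i →
        :ℕ 8 :* l :* ((:1 :+ m) :* (l :* (:1 :+ m :- :1) :+ :ℕ 2) :* i)
        := :ℕ 4 :* l :* ((:1 :+ m) :* (l :* m :+ :ℕ 2)) :* (:ℕ 2 :* i)) refl l (fromℕ m) half)
      (trans (*-congˡ 2*half) (*-identityʳ _))))
    (solve 2 (λ l m →
      :ℕ 4 :* l :* ((:1 :+ m) :* (l :* m :+ :ℕ 2)) :+ (l :- :ℕ 2) :* (l :- :ℕ 2)
      := (:ℕ 2 :* (:1 :+ l :* m) :+ l) :* (:ℕ 2 :* (:1 :+ l :* m) :+ l)) refl l (fromℕ m))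

  module _ {x : ℝ} (e≤x : exp 1# ≤ x) where
    private
      1≤x : 1# ≤ x
      1≤x = ≤-trans 1≤exp1 e≤x

      0≤x : 0# ≤ x
      0≤x = ≤-trans 0≤1 1≤x

      0≤2x : 0# ≤ fromℕ 2 * x
      0≤2x = *-nonNegative (fromℕ-nonNegative 2) 0≤x

      0≤8lx : 0# ≤ fromℕ 8 * l * x
      0≤8lx = *-nonNegative (*-nonNegative (fromℕ-nonNegative 8) 0≤l) 0≤x

      c² : c ^ 2 ≈ c * c
      c² = *-congˡ (*-identityʳ c)

      0≤discriminant : 0# ≤ fromℕ 8 * l * x + c ^ 2
      0≤discriminant = +-nonNegative 0≤8lx
        (≤-trans (square-nonNegative c) (≤-reflexive (sym c²)))

      s p t W R : ℝ
      s = √ x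
      p = √ l
      t = √ (fromℕ 2 * x)
      W = p * t
      R = √ (fromℕ 8 * l * x + c ^ 2)

      0≤s : 0# ≤ s
      0≤s = √-nonNegative 0≤x

      s² : s * s ≈ x
      s² = √-square 0≤x

      1≤√ : ∀ {y} → 1# ≤ y → 1# ≤ √ y
      1≤√ {y} 1≤y = square-cancel-≤ (√-nonNegative 0≤y) (begin
        1# * 1#     ≈⟨ *-identityˡ 1# ⟩
        1#          ≤⟨ 1≤y ⟩
        y           ≈⟨ √-square 0≤y ⟨
        √ y * √ y   ∎)
        where
        0≤y : 0# ≤ y
        0≤y = ≤-trans 0≤1 1≤y

      0<s : 0# < s
      0<s = 1≤⇒0< (1≤√ 1≤x)

      0<t : 0# < t
      0<t = 1≤⇒0< (1≤√ (certify (+-nonNegative (x≤y⇒0≤y-x 1≤x) 0≤x)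
        (solve 1 (λ x → (x :- :1) :+ x := :ℕ 2 :* x :- :1) refl x)))

      0<p : 0# < p
      0<p = 1≤⇒0< (1≤√ 1≤l)

      0<W : 0# < W
      0<W = *-positive 0<p 0<t

      W² : W * W ≈ l * (fromℕ 2 * x)
      W² = trans (solve 2 (λ p t → (p :* t) :* (p :* t) := (p :* p) :* (t :* t)) refl p t)
                 (*-cong (√-square 0≤l) (√-square 0≤2x))

      0≤R : 0# ≤ R
      0≤R = √-nonNegative 0≤discriminant

      R² : R * R ≈ fromℕ 8 * l * x + c * c
      R² = trans (√-square 0≤discriminant) (+-congˡ c²)

      R²≈4W²+c² : R * R ≈ fromℕ 4 * (W * W) + c * c
      R²≈4W²+c² = trans R² (+-congʳ (trans
        (solve 2 (λ l x → :ℕ 8 :* l :* x := :ℕ 4 :* (l :* (:ℕ 2 :* x))) refl l x)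
        (*-congˡ (sym W²))))

      s≤W : s ≤ W
      s≤W = square-cancel-≤ (proj₁ 0<W) (begin
        s * s   ≈⟨ s² ⟩
        x       ≤⟨ certify (+-nonNegative (*-nonNegative (x≤y⇒0≤y-x 1≤l) 0≤2x) 0≤x)
                     (solve 2 (λ l x → (l :- :1) :* (:ℕ 2 :* x) :+ x := l :* (:ℕ 2 :* x) :- x)
                        refl l x) ⟩
        l * (fromℕ 2 * x)  ≈⟨ W² ⟨
        W * W   ∎)

      2W≤R : fromℕ 2 * W ≤ R
      2W≤R = square-cancel-≤ 0≤R (begin
        fromℕ 2 * W * (fromℕ 2 * W)
          ≤⟨ certify (square-nonNegative c)
               (solve 2 (λ W c → c :* c := (:ℕ 4 :* (W :* W) :+ c :* c)
                  :- :ℕ 2 :* W :* (:ℕ 2 :* W)) refl W c) ⟩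
        fromℕ 4 * (W * W) + c * c  ≈⟨ R²≈4W²+c² ⟨
        R * R ∎)

      -- As `(l + 2)² = c² + 8 l`, the slack `l + 2` dominates `c` whichever sign `c = l - 2` has.
      R≤2W+l+2 : R ≤ fromℕ 2 * W + (l + fromℕ 2)
      R≤2W+l+2 = square-cancel-≤ (+-nonNegative (*-nonNegative (fromℕ-nonNegative 2) (proj₁ 0<W)) 0≤l+2)
        (begin
        R * R  ≈⟨ R²≈4W²+c² ⟩
        fromℕ 4 * (W * W) + c * c
          ≤⟨ certify (*-nonNegative (fromℕ-nonNegative 4)
                       (+-nonNegative (*-nonNegative (proj₁ 0<W) 0≤l+2)
                                      (*-nonNegative (fromℕ-nonNegative 2) 0≤l)))
               (solve 2 (λ W l → :ℕ 4 :* (W :* (l :+ :ℕ 2) :+ :ℕ 2 :* l)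
                  := (:ℕ 2 :* W :+ (l :+ :ℕ 2)) :* (:ℕ 2 :* W :+ (l :+ :ℕ 2))
                  :- (:ℕ 4 :* (W :* W) :+ (l :- :ℕ 2) :* (l :- :ℕ 2))) refl W l) ⟩
        (fromℕ 2 * W + (l + fromℕ 2)) * (fromℕ 2 * W + (l + fromℕ 2)) ∎)
        where
        0≤l+2 : 0# ≤ l + fromℕ 2
        0≤l+2 = +-nonNegative 0≤l (fromℕ-nonNegative 2)

      -- The same identity `(l + 2)² = 8 l + c²` leaves the defect `c² (x - 1)`. This bound makes
      -- `Lₙ - x` of order `s`.
      R≤[l+2]s : R ≤ (l + fromℕ 2) * s
      R≤[l+2]s = square-cancel-≤ (*-nonNegative (+-nonNegative 0≤l (fromℕ-nonNegative 2)) 0≤s)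
        (begin
        R * R  ≈⟨ R² ⟩
        fromℕ 8 * l * x + c * c
          ≤⟨ certify (*-nonNegative (square-nonNegative c) (x≤y⇒0≤y-x 1≤x))
               (solve 2 (λ l x → (l :- :ℕ 2) :* (l :- :ℕ 2) :* (x :- :1)
                  := (l :+ :ℕ 2) :* (l :+ :ℕ 2) :* x
                  :- (:ℕ 8 :* l :* x :+ (l :- :ℕ 2) :* (l :- :ℕ 2))) refl l x) ⟩
        (l + fromℕ 2) * (l + fromℕ 2) * x
          ≈⟨ *-congˡ s² ⟨
        (l + fromℕ 2) * (l + fromℕ 2) * (s * s)
          ≈⟨ solve 2 (λ k s → k :* k :* (s :* s) := k :* s :* (k :* s)) refl (l + fromℕ 2) s ⟩
        (l + fromℕ 2) * s * ((l + fromℕ 2) * s) ∎)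

      0<2l : 0# < fromℕ 2 * l
      0<2l = *-positive (fromℕ-positive 1) 0<l

      2l*ν : fromℕ 2 * l * ν ℓ x ≈ R + c
      2l*ν = trans (*-comm _ _) ([x/y]*y≈x 0<2l)

      R+c≤ : ∀ {k} → index ℓ x ≡ k → R + c ≤ fromℕ 2 * l * fromℕ k
      R+c≤ ≡.refl = ≤-trans (≤-reflexive (sym 2l*ν))
        (*-monoˡ-≤ (proj₁ 0<2l) (⌈⌉-upper (ν ℓ x)))

      ≤R+c : ∀ {m} → index ℓ x ≡ suc m → fromℕ 2 * l * fromℕ m ≤ R + c
      ≤R+c eq = ≤-trans (*-monoˡ-≤ (proj₁ 0<2l) (≰⇒≥ (⌈⌉-least (ν ℓ x) eq))) (≤-reflexive 2l*ν)

      -- At index 0 the predecessor in `q` would be a default value. It cannot occur: `R ≥ 2 W ≥ 2`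
      -- and `c ≥ -1` make `ν ℓ x` positive.
      index≢0 : ¬ (index ℓ x ≡ 0)
      index≢0 eq = 1≰0 (begin
        1#      ≤⟨ certify (+-nonNegative (+-nonNegative (x≤y⇒0≤y-x 2W≤R) (x≤y⇒0≤y-x 1≤l))
                     (*-nonNegative (fromℕ-nonNegative 2) (x≤y⇒0≤y-x 1≤W)))
                     (solve 3 (λ R W l → (R :- :ℕ 2 :* W) :+ (l :- :1) :+ :ℕ 2 :* (W :- :1)
                        := R :+ (l :- :ℕ 2) :- :1) refl R W l) ⟩
        R + c   ≤⟨ R+c≤ eq ⟩
        fromℕ 2 * l * 0#  ≈⟨ zeroʳ _ ⟩
        0#      ∎)
        where
        1≤W : 1# ≤ W
        1≤W = ≤-trans (1≤√ 1≤x) s≤W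

      0<8l : 0# < fromℕ 8 * l
      0<8l = *-positive (fromℕ-positive 7) 0<l

      A : ℝ
      A = log x

      0<A : 0# < A
      0<A = 1≤⇒0< (1≤log e≤x)

    mainTerm-positive : 0# < mainTerm x
    mainTerm-positive = *-positive 0<t (⁻¹-positive 0<A)

    private
      module _ {m : ℕ} (index≡ : index ℓ x ≡ suc m) where
        H K Lₙ B : ℝ
        H  = 1# + l * fromℕ m
        -- By `L-square`, `K` is what `R` becomes when `x` is replaced by `Lₙ`, so comparing `K`
        -- with `R` compares `Lₙ` with `x`.
        K  = fromℕ 2 * H + l
        Lₙ = L ℓ (suc m)
        B  = log Lₙ

        R≤K : R ≤ K
        R≤K = certify (x≤y⇒0≤y-x (R+c≤ index≡))
          (solve 3 (λ R l m → :ℕ 2 :* l :* (:1 :+ m) :- (R :+ (l :- :ℕ 2))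
             := (:ℕ 2 :* (:1 :+ l :* m) :+ l) :- R) refl R l (fromℕ m))

        2H≤R+l : fromℕ 2 * H ≤ R + l
        2H≤R+l = certify (x≤y⇒0≤y-x (≤R+c index≡))
          (solve 3 (λ R l m → (R :+ (l :- :ℕ 2)) :- :ℕ 2 :* l :* m
             := (R :+ l) :- :ℕ 2 :* (:1 :+ l :* m)) refl R l (fromℕ m))

        H≤W+κ : H ≤ W + κ
        H≤W+κ = *-cancelˡ-≤ (fromℕ-positive 1)
          (certify (+-nonNegative (x≤y⇒0≤y-x 2H≤R+l) (x≤y⇒0≤y-x R≤2W+l+2))
            (solve 4 (λ R l H W → (R :+ l :- :ℕ 2 :* H) :+ (:ℕ 2 :* W :+ (l :+ :ℕ 2) :- R)
               := :ℕ 2 :* (W :+ (l :+ :1)) :- :ℕ 2 :* H) refl R l H W))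

        W≤H+κ : W ≤ H + κ
        W≤H+κ = *-cancelˡ-≤ (fromℕ-positive 1)
          (certify (+-nonNegative (+-nonNegative (x≤y⇒0≤y-x R≤K) (x≤y⇒0≤y-x 2W≤R))
                                  (+-nonNegative 0≤l (fromℕ-nonNegative 2)))
            (solve 4 (λ R l H W →
               (:ℕ 2 :* H :+ l :- R) :+ (R :- :ℕ 2 :* W) :+ (l :+ :ℕ 2)
               := :ℕ 2 :* (H :+ (l :+ :1)) :- :ℕ 2 :* W) refl R l H W))

        x≤Lₙ : x ≤ Lₙ
        x≤Lₙ = *-cancelˡ-≤ 0<8l (certify (x≤y⇒0≤y-x (begin
          fromℕ 8 * l * x + c * c   ≈⟨ R² ⟨
          R * R                     ≤⟨ *-monoˡ-≤ 0≤R R≤K ⟩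
          R * K                     ≤⟨ *-monoʳ-≤ (≤-trans 0≤R R≤K) R≤K ⟩
          K * K                     ≈⟨ L-square m ⟨
          fromℕ 8 * l * Lₙ + c * c  ∎))
          (solve 3 (λ u v w → (v :+ w) :- (u :+ w) := v :- u) refl
             (fromℕ 8 * l * x) (fromℕ 8 * l * Lₙ) (c * c)))

        -- Minimality of the index keeps `K` within `2 l` of `R`, hence
        -- `8 l (Lₙ - x) ≤ 4 l (R + l)`. Here `R + l ≤ (l + 2) s + l s = 2 κ s`.
        Lₙ≤x+κs : Lₙ ≤ x + κ * s
        Lₙ≤x+κs = *-cancelˡ-≤ 0<8l (certify
          (+-nonNegative (x≤y⇒0≤y-x 8lLₙ+c²≤)
            (*-nonNegative (*-nonNegative (fromℕ-nonNegative 4) 0≤l)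
              (+-nonNegative (x≤y⇒0≤y-x R≤[l+2]s)
                (*-nonNegative 0≤l (x≤y⇒0≤y-x (1≤√ 1≤x))))))
          (solve 6 (λ l c x y R s →
              ((:ℕ 8 :* l :* x :+ c :* c) :+ :ℕ 4 :* l :* (R :+ l) :- (:ℕ 8 :* l :* y :+ c :* c))
              :+ :ℕ 4 :* l :* ((l :+ :ℕ 2) :* s :- R :+ l :* (s :- :1))
              := :ℕ 8 :* l :* (x :+ (l :+ :1) :* s) :- :ℕ 8 :* l :* y) refl l c x Lₙ R s))
          where
          K≤R+2l : K ≤ R + fromℕ 2 * l
          K≤R+2l = certify (x≤y⇒0≤y-x 2H≤R+l)
            (solve 3 (λ R l H → (R :+ l) :- :ℕ 2 :* H
               := (R :+ :ℕ 2 :* l) :- (:ℕ 2 :* H :+ l)) refl R l H)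
          8lLₙ+c²≤ : fromℕ 8 * l * Lₙ + c * c
                     ≤ fromℕ 8 * l * x + c * c + fromℕ 4 * l * (R + l)
          8lLₙ+c²≤ = begin
            fromℕ 8 * l * Lₙ + c * c                   ≈⟨ L-square m ⟩
            K * K                                      ≤⟨ *-monoˡ-≤ (≤-trans 0≤R R≤K) K≤R+2l ⟩
            K * (R + fromℕ 2 * l)
              ≤⟨ *-monoʳ-≤ (+-nonNegative 0≤R (proj₁ 0<2l)) K≤R+2l ⟩
            (R + fromℕ 2 * l) * (R + fromℕ 2 * l)
              ≈⟨ solve 2 (λ R l → (R :+ :ℕ 2 :* l) :* (R :+ :ℕ 2 :* l)
                   := R :* R :+ :ℕ 4 :* l :* (R :+ l)) refl R l ⟩
            R * R + fromℕ 4 * l * (R + l)              ≈⟨ +-congʳ R² ⟩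
            fromℕ 8 * l * x + c * c + fromℕ 4 * l * (R + l) ∎

        δ : ℝ
        δ = κ * s ⁻¹

        0≤δ : 0# ≤ δ
        0≤δ = *-nonNegative 0≤κ (⁻¹-nonNegative 0<s)

        Lₙ≤x[1+δ] : Lₙ ≤ x * (1# + δ)
        Lₙ≤x[1+δ] = ≤-trans Lₙ≤x+κs (≤-reflexive (begin-equality
          x + κ * s                      ≈⟨ +-congˡ (*-identityʳ _) ⟨
          x + κ * s * 1#                 ≈⟨ +-cong (sym s²) (*-congˡ (sym (*-inverseʳ 0<s))) ⟩
          s * s + κ * s * (s * s ⁻¹)
            ≈⟨ solve 3 (λ s k i → s :* s :+ k :* s :* (s :* i) := s :* s :* (:1 :+ k :* i)) refl
                 s κ (s ⁻¹) ⟩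
          s * s * (1# + δ)               ≈⟨ *-congʳ s² ⟩
          x * (1# + δ)                   ∎))

        A≤B : A ≤ B
        A≤B = log-mono e≤x x≤Lₙ

        B≤A+δ : B ≤ A + δ
        B≤A+δ = log-growth e≤x x≤Lₙ 0≤δ Lₙ≤x[1+δ]

        0<B : 0# < B
        0<B = <-≤-trans 0<A A≤B

        1≤B : 1# ≤ B
        1≤B = ≤-trans (1≤log e≤x) A≤B

        -- Since `κ = δ s` and `s ≤ W`, the additive error `κ` in `H` amounts to a relative error
        -- `δ`.
        κB≤δWB : κ * B ≤ δ * (W * B)
        κB≤δWB = begin
          κ * B                    ≈⟨ *-identityʳ _ ⟨
          κ * B * 1#               ≈⟨ *-congˡ (*-inverseʳ 0<s) ⟨
          κ * B * (s * s ⁻¹)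
            ≈⟨ solve 4 (λ k B s i → k :* B :* (s :* i) := (k :* i :* B) :* s) refl κ B s (s ⁻¹) ⟩
          δ * B * s                ≤⟨ *-monoˡ-≤ (*-nonNegative 0≤δ (proj₁ 0<B)) s≤W ⟩
          δ * B * W
            ≈⟨ solve 3 (λ d B W → d :* B :* W := d :* (W :* B)) refl δ B W ⟩
          δ * (W * B)              ∎

        HA≤ : H * A ≤ W * B + (δ * (W * B) + δ * (W * B))
        HA≤ = begin
          H * A                 ≤⟨ *-monoʳ-≤ (proj₁ 0<A) H≤W+κ ⟩
          (W + κ) * A           ≤⟨ *-monoˡ-≤ (+-nonNegative (proj₁ 0<W) 0≤κ) A≤B ⟩
          (W + κ) * B
            -- One `δ * (W * B)` covers `κ * B`; the other is slack that gives both directions the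
            -- same bound.
            ≤⟨ certify (+-nonNegative (x≤y⇒0≤y-x κB≤δWB)
                         (*-nonNegative 0≤δ (proj₁ (*-positive 0<W 0<B))))
                 (solve 4 (λ W k B g → (g :- k :* B) :+ g
                    := (W :* B :+ (g :+ g)) :- (W :+ k) :* B) refl W κ B (δ * (W * B))) ⟩
          W * B + (δ * (W * B) + δ * (W * B)) ∎

        -- Both errors meet here and cost `δ * (W * B)` each: `κ A ≤ κ B` from passing to `H`, and
        -- `W δ` from the logarithm, absorbed through `1 ≤ B`.
        WB≤ : W * B ≤ H * A + (δ * (W * B) + δ * (W * B))
        WB≤ = begin
          W * B            ≤⟨ *-monoˡ-≤ (proj₁ 0<W) B≤A+δ ⟩
          W * (A + δ)
            ≤⟨ certify (+-nonNegative (+-nonNegative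
                   (*-nonNegative (x≤y⇒0≤y-x W≤H+κ) (proj₁ 0<A))
                   (*-nonNegative 0≤κ (x≤y⇒0≤y-x A≤B)))
                   (+-nonNegative (x≤y⇒0≤y-x κB≤δWB)
                     (*-nonNegative (*-nonNegative 0≤δ (proj₁ 0<W)) (x≤y⇒0≤y-x 1≤B))))
                 (solve 6 (λ W A B H k d →
                    (H :+ k :- W) :* A :+ k :* (B :- A)
                    :+ ((d :* (W :* B) :- k :* B) :+ d :* W :* (B :- :1))
                    := (H :* A :+ (d :* (W :* B) :+ d :* (W :* B))) :- W :* (A :+ d))
                    refl W A B H κ δ) ⟩
          H * A + (δ * (W * B) + δ * (W * B)) ∎

        r : ℝ
        r = q ℓ x / mainTerm x

        q-value : q ℓ x * (p * B) ≈ H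
        q-value = trans
          (*-congʳ (unfold index≡))
          (trans ([x/y]*y≈x (*-positive 0<p 0<B)) (h-value m))
          where
          unfold : ∀ {k} → index ℓ x ≡ k →
            q ℓ x ≈ h ℓ (ℕ.pred k) / (p * log (L ℓ k))
          unfold ≡.refl = refl

        -- The `p` in the denominator of `q` joins the `t` of the main term to form `W`. Multiplying
        -- by `W * B` thus turns the error bound into the two product inequalities above.
        ratio : W * B * r ≈ H * A
        ratio = begin-equality
          p * t * B * r
            ≈⟨ *-congʳ (*-congʳ (*-congˡ ([x/y]*y≈x 0<A))) ⟨
          p * (mainTerm x * A) * B * r
            ≈⟨ solve 5 (λ p M A B r → p :* (M :* A) :* B :* r := (r :* M) :* (p :* B) :* A) refl
                 p (mainTerm x) A B r ⟩
          r * mainTerm x * (p * B) * A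
            ≈⟨ *-congʳ (*-congʳ ([x/y]*y≈x mainTerm-positive)) ⟩
          q ℓ x * (p * B) * A
            ≈⟨ *-congʳ q-value ⟩
          H * A ∎

        0<WB : 0# < W * B
        0<WB = *-positive 0<W 0<B

        error-bound-at : ∣ r - 1# ∣ ≤ fromℕ 2 * κ * s ⁻¹
        error-bound-at = ∣x∣≤
          (*-cancelˡ-≤ 0<WB (certify (x≤y⇒0≤y-x HA≤) (trans
            (+-congˡ (-‿cong (sym ratio)))
            (solve 4 (λ V r k i → (V :+ (k :* i :* V :+ k :* i :* V)) :- V :* r
               := V :* (:ℕ 2 :* k :* i) :- V :* (r :- :1)) refl (W * B) r κ (s ⁻¹)))))
          (*-cancelˡ-≤ 0<WB (certify (x≤y⇒0≤y-x WB≤) (trans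
            (+-congʳ (+-congʳ (sym ratio)))
            (solve 4 (λ V r k i → (V :* r :+ (k :* i :* V :+ k :* i :* V)) :- V
               := V :* (r :- :1) :- V :* (:- (:ℕ 2 :* k :* i))) refl (W * B) r κ (s ⁻¹)))))

    error-bound : ∣ q ℓ x / mainTerm x - 1# ∣ ≤ fromℕ 2 * κ * (√ x) ⁻¹
    -- The case split is on a copy of the index together with its equation, which leaves `q ℓ x` in
    -- the goal intact.
    error-bound = go (index ℓ x) ≡.refl
      where
      go : ∀ k → index ℓ x ≡ k → ∣ q ℓ x / mainTerm x - 1# ∣ ≤ fromℕ 2 * κ * (√ x) ⁻¹
      go zero    eq = ⊥-elim (index≢0 eq)
      go (suc m) eq = error-bound-at eq

    q-factorisation : q ℓ x ≈ mainTerm x * (1# + (q ℓ x / mainTerm x - 1#))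
    q-factorisation = sym (trans
      (solve 2 (λ M r → M :* (:1 :+ (r :- :1)) := r :* M) refl
         (mainTerm x) (q ℓ x / mainTerm x))
      ([x/y]*y≈x mainTerm-positive))

    √-large : ∀ {a} → a * a ≤ x → a ≤ s
    √-large a²≤x = square-cancel-≤ 0≤s (≤-trans a²≤x (≤-reflexive (sym s²)))

    √-positive : 0# < s
    √-positive = 0<s

  -- The two asymptotic statements

  private
    C : ℝ
    C = fromℕ 2 * κ

    0≤C : 0# ≤ C
    0≤C = *-nonNegative (fromℕ-nonNegative 2) 0≤κ

  -- With the exact relative error as `E`, the factorisation is an identity wherever the main term
  -- is positive, and the same quantity appears in `IsAsymptotic`; a single bound serves both
  -- claims.
  relativeError : ℝ → ℝ
  relativeError x = q ℓ x / mainTerm x - 1#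

  relativeError-isBigO : IsBigO relativeError (λ x → (√ x) ⁻¹)
  relativeError-isBigO = C , exp 1# , λ x e≤x →
    ≤-trans (error-bound e≤x) (*-monoˡ-≤ 0≤C (x≤∣x∣ _))

  q-isAsymptotic : IsAsymptotic (q ℓ) mainTerm
  -- The sum of the two nonnegative thresholds plays the role of their maximum; `a * a ≤ x` gives
  -- `√ x ≥ C / ε`.
  q-isAsymptotic ε 0<ε = exp 1# + a * a , λ x X≤x →
    let e≤x = ≤-trans (certify (square-nonNegative a)
                (solve 2 (λ e b → b := (e :+ b) :- e) refl (exp 1#) (a * a))) X≤x
        a²≤x = ≤-trans (certify (≤-trans 0≤1 1≤exp1)
                (solve 2 (λ e b → e := (e :+ b) :- b) refl (exp 1#) (a * a))) X≤x
        0<s = √-positive e≤x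
    in ≤-trans (error-bound e≤x) (*-cancelˡ-≤ 0<s (begin
         √ x * (C * (√ x) ⁻¹)
           ≈⟨ solve 3 (λ s C i → s :* (C :* i) := C :* (s :* i)) refl (√ x) C ((√ x) ⁻¹) ⟩
         C * (√ x * (√ x) ⁻¹)   ≈⟨ *-congˡ (*-inverseʳ 0<s) ⟩
         C * 1#                 ≈⟨ *-identityʳ C ⟩
         C                      ≈⟨ [x/y]*y≈x 0<ε ⟨
         a * ε                  ≤⟨ *-monoʳ-≤ (proj₁ 0<ε) (√-large e≤x a²≤x) ⟩
         √ x * ε                ∎))
    where
    a : ℝ
    a = C / ε

lemma4p1 : (𝓡 : RealNumbers) → let open Analysis 𝓡 in
    (ℓ : ℕ) → 1 ℕ.≤ ℓ →
    (∃[ E ] (IsBigO E (λ x → (√ x) ⁻¹)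
    × EventuallyAtTop (λ x → q ℓ x ≈ mainTerm x * (1# + E x))))
    × IsAsymptotic (q ℓ) mainTerm
lemma4p1 𝓡 ℓ 1≤ℓ =
  (relativeError , relativeError-isBigO , exp 1# , λ x → q-factorisation) , q-isAsymptotic
  where
  open Analysis 𝓡 using (exp; 1#)
  open Quotient 𝓡 ℓ 1≤ℓ
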